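{- For every integer $n\ge 5$, the graph $$B_n=Q_n-\{00000\,0^{n-5},\,00001\,0^{n-5},\,00010\,0^{n-5},\,00101\,0^{n-5},\,11011\,1^{n-5},\,11100\,1^{n-5},\,11110\,1^{n-5},\,11111\,1^{n-5}\}$$ is a partial cube with pairwise isomorphic opposite semicubes (that is, for every $\Theta$-class of $B_n$, the two semicubes associated with that $\Theta$-class induce isomorphic subgraphs of $B_n$), but $B_n$ is not antipodal, and, equivalently, not harmonic-even.
   Context: All graphs are undirected, connected, simple and finite; $d_G$ is the usual shortest-path distance. The hypercube $Q_n$ has vertex set $\{0,1\}^n$ (binary words of length $n$), two words being adjacent iff they differ in exactly one coordinate. $0^m$ and $1^m$ denote the words $00\cdots0$ and $11\cdots1$ of length $m$ (empty if $m=0$), and juxtaposition is concatenation. For $S\subseteq V(G)$, $G-S$ is the subgraph induced by $V(G)\setminus S$. A partial cube is a graph isomorphic to an isometric subgraph $H$ of some hypercube, i.e. $d_H(x,y)=d_{Q}(x,y)$ for all $x,y\in V(H)$. The Djokovi\'c–Winkler relation on $E(G)$ is: $uv\,\Theta\,xy$ iff $d_G(u,x)+d_G(v,y)\ne d_G(u,y)+d_G(v,x)$; in a partial cube it is an equivalence relation, and its classes are the $\Theta$-classes. For a $\Theta$-class $E_i$ of a partial cube $G$ and an edge $xy\in E_i$, the two (opposite) semicubes associated with $E_i$ are the sets $W_i^0=\{a\in V(G): d_G(x,a)<d_G(y,a)\}$ and $W_i^1=\{a\in V(G): d_G(y,a)<d_G(x,a)\}$ (independent of the choice of $xy\in E_i$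 up to interchanging the labels $0,1$), and also the subgraphs $G[W_i^0]$, $G[W_i^1]$ they induce. A vertex $y$ is a relative antipode of $x$ in $G$ if $d_G(x,y)\ge d_G(x,z)$ for every neighbor $z$ of $y$. $G$ is antipodal if every vertex has exactly one relative antipode. An absolute antipode of $x$ is a vertex at distance $\operatorname{diam}(G)$ from $x$. $G$ is even if every vertex $x$ has a unique absolute antipode $\bar x$, and harmonic-even if it is even and $x\mapsto\bar x$ is an automorphism of $G$. -}

module Defs where

open import Data.Bool using (Bool; true; false)
import Data.Bool.Properties as Bool
open import Data.Empty using (⊥-elim-irr)
open import Data.Fin using (zero; suc)
import Data.Fin.Properties as Fin
open import Data.Irrelevant using ([_])
open import Data.List using (List; []; _∷_; _++_; replicate; mapMaybe; map; cartesianProductWith)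
open import Data.List.Extrema.Nat using (max)
open import Data.List.Membership.DecPropositional using (_∈?_)
open import Data.List.Membership.Propositional using (_∈_; lose)
open import Data.List.Membership.Propositional.Properties using (∈-cartesianProductWith⁺)
import Data.List.Properties as List
open import Data.List.Relation.Unary.Any as Any using (Any; here; there; any?)
import Data.List.Relation.Unary.Any.Properties as Any
open import Data.List.Relation.Unary.Enumerates.Setoid using (IsEnumeration)
open import Data.Maybe using (Maybe; just; nothing)
import Data.Maybe.Relation.Unary.Any as Maybe
open import Data.Nat using (ℕ; zero; suc; _+_; _∸_; _≤_; _<_; z≤n; s≤s; _<?_)
open import Data.Product using (∃; ∃!; ∃-syntax; Σ-syntax; _×_; _,_; proj₁)
open import Data.Refinement using (Refinement; value; _,_)
import Data.Refinement.Properties as Refinement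
open import Data.Vec using (Vec; []; _∷_; lookup; toList)
import Data.Vec.Properties as Vec
open import Function using (_∘_; _⇔_; Bijective)
open import Level using (0ℓ)
open import Relation.Binary using (Rel; Decidable; DecidableEquality; Symmetric; Irreflexive)
open import Relation.Binary.PropositionalEquality using (_≡_; _≢_; refl; sym; cong; setoid)
open import Relation.Nullary using (Dec; yes; no; ¬?; contradiction)
open import Relation.Nullary.Decidable using (map′; _×-dec_; _→-dec_)
open import Relation.Unary using (Pred) renaming (Decidable to Decidable₁)
open import Relation.Unary.Properties using (∁?)

-- Connectedness is imposed separately (ConnectedGraph), because a vertex
-- deletion or an induced subgraph need not be connected.

record Graph : Set₁ where
  infix 4 _≟_
  field
    Vertex   : Set
    _≟_      : DecidableEquality Vertex
    vertices : List Vertex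
    complete : IsEnumeration (setoid Vertex) vertices
    Adj      : Rel Vertex 0ℓ
    adj?     : Decidable Adj
    symm     : Symmetric Adj
    irrefl   : Irreflexive _≡_ Adj

open Graph public using (Vertex; vertices; Adj)

record IsIsomorphism (G H : Graph) (f : Vertex G → Vertex H) : Set where
  field
    bijective : Bijective _≡_ _≡_ f
    adjacency : ∀ x y → Adj G x y ⇔ Adj H (f x) (f y)

infix 4 _≅_

_≅_ : Graph → Graph → Set
G ≅ H = ∃ (IsIsomorphism G H)

IsAutomorphism : (G : Graph) → (Vertex G → Vertex G) → Set
IsAutomorphism G = IsIsomorphism G G

filterEnum : {A : Set} {P : Pred A 0ℓ} → Decidable₁ P → List A → List (Refinement A P)
filterEnum {A} {P} P? = mapMaybe select
  module FilterEnum where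
  select : A → Maybe (Refinement A P)
  select x with P? x
  ... | yes p = just (x , [ p ])
  ... | no  _ = nothing

filterEnum-complete : {A : Set} {P : Pred A 0ℓ} (P? : Decidable₁ P) {xs : List A} →
  IsEnumeration (setoid A) xs → IsEnumeration (setoid (Refinement A P)) (filterEnum P? xs)
filterEnum-complete {A} {P} P? {xs} all r@(x , [ p ]) =
  Any.mapMaybe⁺ select xs (Any.map⁺ (lose (all x) hit))
  where
  open FilterEnum P?
  hit : Maybe.Any (r ≡_) (select x)
  hit with P? x
  ... | yes _ = Maybe.just refl
  ... | no ¬p = ⊥-elim-irr (¬p p)

-- Only the part of _~_ relating vertices that satisfy Kept matters.

record Subgraph (G : Graph) : Set₁ where
  infix 4 _~_
  field
    Kept  : Pred (Vertex G) 0ℓ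
    kept? : Decidable₁ Kept
    _~_   : Rel (Vertex G) 0ℓ
    ~?    : Decidable _~_
    ~-sym : Symmetric _~_
    ~⊆Adj : ∀ {x y} → x ~ y → Adj G x y

subgraph : {G : Graph} → Subgraph G → Graph
subgraph {G} H = record
  { Vertex   = Refinement (Vertex G) Kept
  ; _≟_      = Refinement._≟_ (Graph._≟_ G)
  ; vertices = filterEnum kept? (vertices G)
  ; complete = filterEnum-complete kept? (Graph.complete G)
  ; Adj      = λ x y → value x ~ value y
  ; adj?     = λ x y → ~? (value x) (value y)
  ; symm     = ~-sym
  ; irrefl   = λ { refl x~x → Graph.irrefl G refl (~⊆Adj x~x) }
  }
  where open Subgraph H

induced : (G : Graph) {P : Pred (Vertex G) 0ℓ} → Decidable₁ P → Graph
induced G P? = subgraph {G} record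
  { kept? = P? ; ~? = Graph.adj? G ; ~-sym = Graph.symm G ; ~⊆Adj = λ e → e }

infixl 6 _─_

_─_ : (G : Graph) {S : Pred (Vertex G) 0ℓ} → Decidable₁ S → Graph
G ─ S? = induced G (∁? S?)

data Walk (G : Graph) : Vertex G → Vertex G → ℕ → Set where
  []  : ∀ {x} → Walk G x x zero
  _∷_ : ∀ {x y z k} → Adj G x y → Walk G y z k → Walk G x z (suc k)

walk? : (G : Graph) → ∀ x y → Decidable₁ (Walk G x y)
walk? G x y zero    = map′ (λ { refl → [] }) (λ { [] → refl }) (Graph._≟_ G x y)
walk? G x y (suc k) = map′ from to
  (any? (λ z → Graph.adj? G x z ×-dec walk? G z y k) (vertices G))
  where
  Step : Vertex G → Set
  Step z = Adj G x z × Walk G z y k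
  from : Any Step (vertices G) → Walk G x y (suc k)
  from s = let _ , e , w = Any.satisfied s in e ∷ w
  to : Walk G x y (suc k) → Any Step (vertices G)
  to (e ∷ w) = lose (Graph.complete G _) (e , w)

Connected : Graph → Set
Connected G = ∀ x y → ∃[ k ] Walk G x y k

record ConnectedGraph : Set₁ where
  constructor _,_
  field
    graph     : Graph
    connected : Connected graph

open ConnectedGraph public

V : ConnectedGraph → Set
V G = Vertex (graph G)

least : {P : Pred ℕ 0ℓ} → Decidable₁ P → ∀ n → P n →
        ∃[ k ] P k × (∀ {j} → P j → k ≤ j)
least P? zero    p = zero , p , λ _ → z≤n
least {P} P? (suc n) p with P? zero
... | yes p₀ = zero , p₀ , λ _ → z≤n
... | no ¬p₀ with least (P? ∘ suc) n p
...   | k , pk , min = suc k , pk , λ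
  { {zero}  p₀ → contradiction p₀ ¬p₀
  ; {suc j} pj → s≤s (min pj) }

shortest : (G : ConnectedGraph) → ∀ x y →
  ∃[ k ] Walk (graph G) x y k × (∀ {j} → Walk (graph G) x y j → k ≤ j)
shortest G x y = let k , w = connected G x y in least (walk? (graph G) x y) k w

dist : (G : ConnectedGraph) → V G → V G → ℕ
dist G x y = proj₁ (shortest G x y)

diam : ConnectedGraph → ℕ
diam G = max 0 (cartesianProductWith (dist G) (vertices (graph G)) (vertices (graph G)))

words : ∀ n → List (Vec Bool n)
words zero    = [] ∷ []
words (suc n) = cartesianProductWith _∷_ (false ∷ true ∷ []) (words n)

words-complete : ∀ n → IsEnumeration (setoid (Vec Bool n)) (words n)
words-complete zero    []      = here refl
words-complete (suc n) (b ∷ w) = ∈-cartesianProductWith⁺ _∷_ (bit b) (words-complete n w)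
  where
  bit : ∀ b → b ∈ false ∷ true ∷ []
  bit false = here refl
  bit true  = there (here refl)

DifferInOne : ∀ {n} → Rel (Vec Bool n) 0ℓ
DifferInOne u v = ∃! _≡_ (λ i → lookup u i ≢ lookup v i)

differInOne? : ∀ {n} → Decidable (DifferInOne {n})
differInOne? u v = map′
  (λ (i , d , un) → i , d , λ {j} → un j)
  (λ (i , d , un) → i , d , λ j → un {j})
  (Fin.any? λ i → differ? i ×-dec Fin.all? (λ j → differ? j →-dec (i Fin.≟ j)))
  where
  differ? : ∀ i → Dec (lookup u i ≢ lookup v i)
  differ? i = ¬? (lookup u i Bool.≟ lookup v i)

Q : ℕ → Graph
Q n = record
  { Vertex   = Vec Bool n
  ; _≟_      = Vec.≡-dec Bool._≟_
  ; vertices = words n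
  ; complete = words-complete n
  ; Adj      = DifferInOne
  ; adj?     = differInOne?
  ; symm     = λ (i , d , un) → i , d ∘ sym , λ d′ → un (d′ ∘ sym)
  ; irrefl   = λ { refl (i , d , _) → d refl }
  }

prefix : ∀ {n u v k} b → Walk (Q n) u v k → Walk (Q (suc n)) (b ∷ u) (b ∷ v) k
prefix b []                 = []
prefix b ((i , d , un) ∷ w) = (suc i , d , λ
  { {zero}  d′ → contradiction refl d′
  ; {suc j} d′ → cong suc (un d′) }) ∷ prefix b w

Q-connected : ∀ n → Connected (Q n)
Q-connected zero    []      []      = zero , []
Q-connected (suc n) (a ∷ u) (b ∷ v) with Q-connected n u v | a Bool.≟ b
... | k , w | yes refl = k , prefix a w
... | k , w | no a≢b   = suc k , flip ∷ prefix b w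
  where
  flip : DifferInOne (a ∷ u) (b ∷ u)
  flip = zero , a≢b , λ
    { {zero}  _  → refl
    ; {suc j} d′ → contradiction refl d′ }

hypercube : ℕ → ConnectedGraph
hypercube n = Q n , Q-connected n

IsIsometric : (G : ConnectedGraph) → Subgraph (graph G) → Set
IsIsometric G H = Σ[ c ∈ Connected (subgraph H) ]
  (∀ x y → dist (subgraph H , c) x y ≡ dist G (value x) (value y))

IsPartialCube : ConnectedGraph → Set₁
IsPartialCube G = ∃[ m ] Σ[ H ∈ Subgraph (Q m) ]
  IsIsometric (hypercube m) H × graph G ≅ subgraph H

module _ (G : ConnectedGraph) where

  private d = dist G

  Θ : (u v x y : V G) → Set
  Θ u v x y = d u x + d v y ≢ d u y + d v x

  -- The class of the edge uv, an edge xy being represented by both of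
  -- the ordered pairs (x , y) and (y , x).
  ΘClass : (u v : V G) → Rel (V G) 0ℓ
  ΘClass u v x y = Adj (graph G) x y × Θ u v x y

  Closer : (x y : V G) → Pred (V G) 0ℓ
  Closer x y a = d x a < d y a

  closer? : ∀ x y → Decidable₁ (Closer x y)
  closer? x y a = d x a <? d y a

  semicube : (x y : V G) → Graph
  semicube x y = induced (graph G) (closer? x y)

  HasIsomorphicOppositeSemicubes : Set
  HasIsomorphicOppositeSemicubes =
    ∀ u v → Adj (graph G) u v →
    ∀ x y → ΘClass u v x y → semicube x y ≅ semicube y x

  IsRelativeAntipode : (x y : V G) → Set
  IsRelativeAntipode x y = ∀ z → Adj (graph G) y z → d x z ≤ d x y

  IsAntipodal : Set
  IsAntipodal = ∀ x → ∃! _≡_ (IsRelativeAntipode x)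

  IsAbsoluteAntipode : (x y : V G) → Set
  IsAbsoluteAntipode x y = d x y ≡ diam G

  IsEven : Set
  IsEven = ∀ x → ∃! _≡_ (IsAbsoluteAntipode x)

  IsHarmonicEven : Set
  IsHarmonicEven = Σ[ e ∈ IsEven ] IsAutomorphism (graph G) (λ x → proj₁ (e x))

private
  pattern O = false
  pattern I = true

-- The deleted words, with m = n - 5 trailing letters. They are plain lists,
-- to be compared with toList w, so that no cast between Vec Bool n and
-- Vec Bool (5 + m) is needed.
deletedWords : ℕ → List (List Bool)
deletedWords m =
    map (_++ replicate m O)
      ( (O ∷ O ∷ O ∷ O ∷ O ∷ [])
      ∷ (O ∷ O ∷ O ∷ O ∷ I ∷ [])
      ∷ (O ∷ O ∷ O ∷ I ∷ O ∷ [])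
      ∷ (O ∷ O ∷ I ∷ O ∷ I ∷ [])
      ∷ [])
  ++ map (_++ replicate m I)
      ( (I ∷ I ∷ O ∷ I ∷ I ∷ [])
      ∷ (I ∷ I ∷ I ∷ O ∷ O ∷ [])
      ∷ (I ∷ I ∷ I ∷ I ∷ O ∷ [])
      ∷ (I ∷ I ∷ I ∷ I ∷ I ∷ [])
      ∷ [])

Deleted : ∀ n → Pred (Vec Bool n) 0ℓ
Deleted n w = toList w ∈ deletedWords (n ∸ 5)

deleted? : ∀ n → Decidable₁ (Deleted n)
deleted? n w = _∈?_ (List.≡-dec Bool._≟_) (toList w) (deletedWords (n ∸ 5))

-- Meaningful for n ≥ 5 only.
B : ℕ → Graph
B n = Q n ─ deleted? n

{-# OPTIONS --safe #-}

-- B n is isometric in Q n, so distances are Hamming distances and the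
-- semicubes are the halves {a : aᵢ = b}. Two involutive automorphisms of Q n
-- preserve the set of deleted words: translation by 11110·1ⁿ⁻⁵, which flips
-- every coordinate but the fifth, and complementation followed by the exchange
-- of the third and fourth coordinates, which flips the fifth. They exchange
-- opposite semicubes. On the other hand 00100·0ⁿ⁻⁵ is kept while its
-- complement is deleted, so this vertex has several relative antipodes and no
-- vertex at distance diam = n.

module Submission where

open import Defs
open import Data.Bool using (Bool; true; false; not; if_then_else_)
import Data.Bool.Properties as Bool
open import Data.Empty using (⊥-elim-irr)
open import Data.Fin using (Fin; zero; suc; _↑ʳ_)
import Data.Fin.Properties as Fin
open import Data.Irrelevant using ([_])
open import Data.List as List using (List; []; _∷_)
open import Data.List.Membership.DecPropositional using (_∈?_)
open import Data.List.Membership.Propositional using (_∈_)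
open import Data.List.Membership.Propositional.Properties
  using (∈-++⁺ˡ; ∈-++⁺ʳ; ∈-++⁻; ∈-map⁺; ∈-map⁻; ∈-cartesianProductWith⁺)
open import Data.List.Extrema.Nat using (xs≤max)
open import Data.List.Relation.Unary.All as All using (all?)
open import Data.List.Relation.Unary.Any using (here)
open import Data.Nat using (ℕ; zero; suc; _+_; _≤_; _<_; z≤n; s≤s; s≤s⁻¹)
import Data.Nat.Properties as ℕ
open import Data.Product using (Σ-syntax; ∃; ∃-syntax; _×_; _,_; proj₁; proj₂)
open import Data.Refinement using (value; _,_)
import Data.Refinement.Properties as Refinement
open import Data.Sum using (inj₁; inj₂; [_,_]′)
open import Data.Vec using (Vec; []; _∷_; _++_; lookup; map; replicate; splitAt; tabulate; toList; updateAt)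
import Data.Vec.Properties as Vec
open import Function using (_∘_; _⇔_; mk⇔; id; Equivalence)
open import Level using (0ℓ)
open import Relation.Binary using (DecidableEquality)
open import Relation.Binary.PropositionalEquality
open import Relation.Nullary using (¬_; Dec; yes; no; does; ¬?; contradiction)
open import Relation.Nullary.Decidable
  using (map′; from-yes; _×-dec_; _⊎-dec_; _→-dec_; decidable-stable; dec-true)
open import Relation.Unary using (Pred) renaming (Decidable to Decidable₁)
open import Relation.Unary.Properties using (∁?)

private
  pattern O = false
  pattern I = true

  variable
    m n k : ℕ

-- Hamming distance

differ : Bool → Bool → ℕ
differ O O = 0
differ O I = 1
differ I O = 1
differ I I = 0

hamming : Vec Bool n → Vec Bool n → ℕ
hamming []      []      = 0
hamming (a ∷ u) (b ∷ v) = differ a b + hamming u v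

flip : Vec Bool n → Fin n → Vec Bool n
flip u i = updateAt u i not

_≟ᵂ_ : DecidableEquality (Vec Bool n)
_≟ᵂ_ = Vec.≡-dec Bool._≟_

lookup-ext : {u v : Vec Bool n} → (∀ i → lookup u i ≡ lookup v i) → u ≡ v
lookup-ext {u = u} {v} eq = begin
  u                   ≡⟨ Vec.tabulate∘lookup u ⟨
  tabulate (lookup u) ≡⟨ Vec.tabulate-cong eq ⟩
  tabulate (lookup v) ≡⟨ Vec.tabulate∘lookup v ⟩
  v                   ∎
  where open ≡-Reasoning

differing-coordinate : (u v : Vec Bool n) → u ≢ v → ∃[ i ] lookup u i ≢ lookup v i
differing-coordinate {n} u v u≢v =
  Fin.¬∀⟶∃¬ n (λ i → lookup u i ≡ lookup v i) (λ i → lookup u i Bool.≟ lookup v i)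
    (u≢v ∘ lookup-ext)

hamming-refl : (u : Vec Bool n) → hamming u u ≡ 0
hamming-refl []      = refl
hamming-refl (O ∷ u) = hamming-refl u
hamming-refl (I ∷ u) = hamming-refl u

hamming≡1+k⇒≢ : (u v : Vec Bool n) → hamming u v ≡ suc k → u ≢ v
hamming≡1+k⇒≢ u u h≡1+k refl = ℕ.0≢1+n (trans (sym (hamming-refl u)) h≡1+k)

hamming≡0⇒≡ : (u v : Vec Bool n) → hamming u v ≡ 0 → u ≡ v
hamming≡0⇒≡ []      []      _  = refl
hamming≡0⇒≡ (O ∷ u) (O ∷ v) eq = cong (O ∷_) (hamming≡0⇒≡ u v eq)
hamming≡0⇒≡ (I ∷ u) (I ∷ v) eq = cong (I ∷_) (hamming≡0⇒≡ u v eq)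

hamming≤n : (u v : Vec Bool n) → hamming u v ≤ n
hamming≤n []      []      = z≤n
hamming≤n (O ∷ u) (O ∷ v) = ℕ.m≤n⇒m≤1+n (hamming≤n u v)
hamming≤n (O ∷ u) (I ∷ v) = s≤s (hamming≤n u v)
hamming≤n (I ∷ u) (O ∷ v) = s≤s (hamming≤n u v)
hamming≤n (I ∷ u) (I ∷ v) = ℕ.m≤n⇒m≤1+n (hamming≤n u v)

n≤hamming⇒complement : (u v : Vec Bool n) → n ≤ hamming u v → v ≡ map not u
n≤hamming⇒complement []      []      _         = refl
n≤hamming⇒complement (O ∷ u) (O ∷ v) n<h       = contradiction (hamming≤n u v) (ℕ.<⇒≱ n<h)
n≤hamming⇒complement (O ∷ u) (I ∷ v) (s≤s n≤h) = cong (I ∷_) (n≤hamming⇒complement u v n≤h)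
n≤hamming⇒complement (I ∷ u) (O ∷ v) (s≤s n≤h) = cong (O ∷_) (n≤hamming⇒complement u v n≤h)
n≤hamming⇒complement (I ∷ u) (I ∷ v) n<h       = contradiction (hamming≤n u v) (ℕ.<⇒≱ n<h)

hamming-replicate : ∀ n → hamming (replicate n O) (replicate n I) ≡ n
hamming-replicate zero    = refl
hamming-replicate (suc n) = cong suc (hamming-replicate n)

hamming-++ : (p q : Vec Bool m) (t s : Vec Bool n) →
  hamming (p ++ t) (q ++ s) ≡ hamming p q + hamming t s
hamming-++ []      []      t s = refl
hamming-++ (a ∷ p) (b ∷ q) t s =
  trans (cong (differ a b +_) (hamming-++ p q t s))
        (sym (ℕ.+-assoc (differ a b) (hamming p q) (hamming t s)))

hamming-map-not : (u v : Vec Bool n) → hamming (map not u) (map not v) ≡ hamming u v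
hamming-map-not []      []      = refl
hamming-map-not (O ∷ u) (O ∷ v) = hamming-map-not u v
hamming-map-not (O ∷ u) (I ∷ v) = cong suc (hamming-map-not u v)
hamming-map-not (I ∷ u) (O ∷ v) = cong suc (hamming-map-not u v)
hamming-map-not (I ∷ u) (I ∷ v) = hamming-map-not u v

hamming-flip-same : (u w : Vec Bool n) (i : Fin n) → lookup u i ≡ lookup w i →
  hamming (flip u i) w ≡ suc (hamming u w)
hamming-flip-same (O ∷ u) (O ∷ w) zero    eq = refl
hamming-flip-same (I ∷ u) (I ∷ w) zero    eq = refl
hamming-flip-same (a ∷ u) (b ∷ w) (suc i) eq =
  trans (cong (differ a b +_) (hamming-flip-same u w i eq)) (ℕ.+-suc (differ a b) (hamming u w))

hamming-flip-differ : (u w : Vec Bool n) (i : Fin n) → lookup u i ≢ lookup w i →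
  suc (hamming (flip u i) w) ≡ hamming u w
hamming-flip-differ (O ∷ u) (O ∷ w) zero    neq = contradiction refl neq
hamming-flip-differ (O ∷ u) (I ∷ w) zero    neq = refl
hamming-flip-differ (I ∷ u) (O ∷ w) zero    neq = refl
hamming-flip-differ (I ∷ u) (I ∷ w) zero    neq = contradiction refl neq
hamming-flip-differ (a ∷ u) (b ∷ w) (suc i) neq =
  trans (sym (ℕ.+-suc (differ a b) (hamming (flip u i) w)))
        (cong (differ a b +_) (hamming-flip-differ u w i neq))

flip-adjacent : (u : Vec Bool n) (i : Fin n) → DifferInOne u (flip u i)
flip-adjacent u i =
    i
  , (λ eq → Bool.not-¬ (sym eq) (Vec.lookup∘updateAt i u))
  , λ {j} neq → decidable-stable (i Fin.≟ j) λ i≢j →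
      neq (sym (Vec.lookup∘updateAt′ j i (i≢j ∘ sym) u))

adjacent⇒flip : (u v : Vec Bool n) ((i , _) : DifferInOne u v) → v ≡ flip u i
adjacent⇒flip u v (i , d , un) = lookup-ext coordinate
  where
  coordinate : ∀ j → lookup v j ≡ lookup (flip u i) j
  coordinate j with i Fin.≟ j
  ... | yes refl = trans (Bool.¬-not (d ∘ sym)) (sym (Vec.lookup∘updateAt i u))
  ... | no i≢j   = trans
    (sym (decidable-stable (lookup u j Bool.≟ lookup v j) (i≢j ∘ un)))
    (sym (Vec.lookup∘updateAt′ j i (i≢j ∘ sym) u))

hamming-adjacent-same : (u v : Vec Bool n) ((i , _) : DifferInOne u v) (w : Vec Bool n) →
  lookup u i ≡ lookup w i → hamming v w ≡ suc (hamming u w)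
hamming-adjacent-same u v e@(i , _) w eq =
  trans (cong (λ x → hamming x w) (adjacent⇒flip u v e)) (hamming-flip-same u w i eq)

hamming-adjacent-differ : (u v : Vec Bool n) ((i , _) : DifferInOne u v) (w : Vec Bool n) →
  lookup u i ≢ lookup w i → suc (hamming v w) ≡ hamming u w
hamming-adjacent-differ u v e@(i , _) w neq =
  trans (cong (λ x → suc (hamming x w)) (adjacent⇒flip u v e)) (hamming-flip-differ u w i neq)

-- Crossing an edge changes the Hamming distance to `w` by exactly one, up or down. This gives the
-- lower bound on the length of walks.
adjacent⇒hamming≤ : (u v : Vec Bool n) → DifferInOne u v → ∀ w →
  hamming u w ≤ suc (hamming v w)
adjacent⇒hamming≤ u v e@(i , _) w with lookup u i Bool.≟ lookup w i
... | yes eq = ℕ.≤-trans (ℕ.n≤1+n _)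
  (ℕ.m≤n⇒m≤1+n (ℕ.≤-reflexive (sym (hamming-adjacent-same u v e w eq))))
... | no neq = ℕ.≤-reflexive (sym (hamming-adjacent-differ u v e w neq))

-- Replaces the unique-coordinate form of adjacency by a numerical one, which is additive over `++`
-- and visibly preserved by isometries of words.
adjacent⇔hamming≡1 : (u v : Vec Bool n) → DifferInOne u v ⇔ (hamming u v ≡ 1)
adjacent⇔hamming≡1 u v = mk⇔ to from
  where
  to : DifferInOne u v → hamming u v ≡ 1
  to e@(_ , d , _) =
    trans (sym (hamming-adjacent-differ u v e v d)) (cong suc (hamming-refl v))
  from : hamming u v ≡ 1 → DifferInOne u v
  from h≡1 with differing-coordinate u v (hamming≡1+k⇒≢ u v h≡1)
  ... | i , d = subst (DifferInOne u)
    (hamming≡0⇒≡ (flip u i) v (ℕ.suc-injective (trans (hamming-flip-differ u v i d) h≡1)))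
    (flip-adjacent u i)

-- Isometric embeddings into the hypercube

dist≡ : (G : ConnectedGraph) {x y : V G} → Walk (graph G) x y k →
  (∀ {j} → Walk (graph G) x y j → k ≤ j) → dist G x y ≡ k
dist≡ G {x} {y} w minimal with shortest G x y
... | _ , w′ , minimal′ = ℕ.≤-antisym (minimal′ w) (minimal w′)

-- A local criterion for isometry. If from every `x` some edge leads one unit closer to a given `y`,
-- then following such edges yields a walk of length equal to the Hamming distance, and no walk can
-- be shorter. Connectedness comes out at the same time.
module IsometricEmbedding
  (G : Graph) (f : Vertex G → Vec Bool n)
  (injective : ∀ {x y} → f x ≡ f y → x ≡ y)
  (adjacent : ∀ {x y} → Adj G x y → DifferInOne (f x) (f y))
  (step : ∀ x y → f x ≢ f y → ∃[ z ] Adj G x z × suc (hamming (f z) (f y)) ≡ hamming (f x) (f y))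
  where

  hamming≤length : ∀ {x y} → Walk G x y k → hamming (f x) (f y) ≤ k
  hamming≤length {x = x} []      = ℕ.≤-reflexive (hamming-refl (f x))
  hamming≤length {x = x} {y} (_∷_ {y = z} e w) =
    ℕ.≤-trans (adjacent⇒hamming≤ (f x) (f z) (adjacent e) (f y)) (s≤s (hamming≤length w))

  geodesic : ∀ k x y → hamming (f x) (f y) ≡ k → Walk G x y k
  geodesic zero    x y h≡0 with refl ← injective (hamming≡0⇒≡ (f x) (f y) h≡0) = []
  geodesic (suc k) x y h≡1+k
    with z , e , closer ← step x y (hamming≡1+k⇒≢ (f x) (f y) h≡1+k)
    = e ∷ geodesic k z y (ℕ.suc-injective (trans closer h≡1+k))

  connected′ : Connected G
  connected′ x y = hamming (f x) (f y) , geodesic _ x y refl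

  dist≡hamming : (c : Connected G) → ∀ x y → dist (G , c) x y ≡ hamming (f x) (f y)
  dist≡hamming c x y = dist≡ (G , c) (geodesic _ x y refl) hamming≤length

hypercube-dist : (u v : Vec Bool n) → dist (hypercube n) u v ≡ hamming u v
hypercube-dist {n} = IsometricEmbedding.dist≡hamming (Q n) id id (λ e → e)
  (λ u v u≢v → let i , d = differing-coordinate u v u≢v in
    flip u i , flip-adjacent u i , hamming-flip-differ u v i d)
  (Q-connected n)

-- Deleted words

-- The index is also the letter of the constant tail that completes these prefixes to deleted words.
deletedPrefixes : Bool → List (Vec Bool 5)
deletedPrefixes O =
    (O ∷ O ∷ O ∷ O ∷ O ∷ [])
  ∷ (O ∷ O ∷ O ∷ O ∷ I ∷ [])
  ∷ (O ∷ O ∷ O ∷ I ∷ O ∷ [])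
  ∷ (O ∷ O ∷ I ∷ O ∷ I ∷ [])
  ∷ []
deletedPrefixes I =
    (I ∷ I ∷ O ∷ I ∷ I ∷ [])
  ∷ (I ∷ I ∷ I ∷ O ∷ O ∷ [])
  ∷ (I ∷ I ∷ I ∷ I ∷ O ∷ [])
  ∷ (I ∷ I ∷ I ∷ I ∷ I ∷ [])
  ∷ []

-- Cutting words after five letters separates a finite condition on the prefix, decidable by
-- enumeration, from the only part that depends on `m`.
DeletedSplit : Vec Bool 5 → Vec Bool m → Set
DeletedSplit {m} p t = ∃[ b ] p ∈ deletedPrefixes b × t ≡ replicate m b

extendBy : ∀ m → Bool → Vec Bool 5 → List Bool
extendBy m b l = toList l List.++ List.replicate m b

toList-extend : ∀ (l : Vec Bool 5) b → toList (l ++ replicate m b) ≡ extendBy m b l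
toList-extend {m} l b =
  trans (Vec.toList-++ l (replicate m b)) (cong (toList l List.++_) (Vec.toList-replicate m b))

toList-injective : {u v : Vec Bool n} → toList u ≡ toList v → u ≡ v
toList-injective {u = u} {v} eq =
  trans (sym (Vec.cast-is-id refl u)) (Vec.toList-injective refl u v eq)

deleted⁺ : (p : Vec Bool 5) (t : Vec Bool m) → DeletedSplit p t → Deleted (5 + m) (p ++ t)
deleted⁺ {m} p t (b , p∈ , refl) =
  subst (_∈ deletedWords m) (sym (toList-extend p b)) (cases b p∈)
  where
  cases : ∀ b → p ∈ deletedPrefixes b → extendBy m b p ∈ deletedWords m
  cases O p∈ = ∈-++⁺ˡ (∈-map⁺ (extendBy m O) p∈)
  cases I p∈ = ∈-++⁺ʳ (List.map (extendBy m O) (deletedPrefixes O)) (∈-map⁺ (extendBy m I) p∈)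

deleted⁻ : (p : Vec Bool 5) (t : Vec Bool m) → Deleted (5 + m) (p ++ t) → DeletedSplit p t
deleted⁻ {m} p t del =
  [ split O ∘ ∈-map⁻ (extendBy m O) , split I ∘ ∈-map⁻ (extendBy m I) ]′
    (∈-++⁻ (List.map (extendBy m O) (deletedPrefixes O)) del)
  where
  split : ∀ b → ∃[ l ] l ∈ deletedPrefixes b × toList (p ++ t) ≡ extendBy m b l → DeletedSplit p t
  split b (l , l∈ , eq)
    with refl , t≡ ← Vec.++-injective p l (toList-injective (trans eq (sym (toList-extend l b))))
    = b , l∈ , t≡

-- Geodesics avoiding the deleted words

∀-bit? : {P : Pred Bool 0ℓ} → Decidable₁ P → Dec (∀ b → P b)
∀-bit? P? = map′ (λ { (o , i) O → o ; (o , i) I → i }) (λ p → p O , p I) (P? O ×-dec P? I)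

∃-bit? : {P : Pred Bool 0ℓ} → Decidable₁ P → Dec (∃ P)
∃-bit? P? = map′ [ O ,_ , I ,_ ]′ (λ { (O , o) → inj₁ o ; (I , i) → inj₂ i }) (P? O ⊎-dec P? I)

∀-word? : {P : Pred (Vec Bool n) 0ℓ} → Decidable₁ P → Dec (∀ w → P w)
∀-word? {n} P? = map′
  (λ all w → All.lookup all (words-complete n w)) (λ p → All.tabulate λ {w} _ → p w)
  (all? P? (words n))

prefix? : ∀ b (p : Vec Bool 5) → Dec (p ∈ deletedPrefixes b)
prefix? b p = _∈?_ _≟ᵂ_ p (deletedPrefixes b)

-- The prefixes to avoid when the tail is fixed; the bits ends say whether
-- this tail is 0ᵐ and whether it is 1ᵐ (both hold if m = 0).
Blocked : Bool × Bool → Pred (Vec Bool 5) 0ℓ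
Blocked (o , i) p = ∃[ b ] (if b then i else o) ≡ true × p ∈ deletedPrefixes b

blocked? : ∀ ends → Decidable₁ (Blocked ends)
blocked? (o , i) p = ∃-bit? λ b → ((if b then i else o) Bool.≟ true) ×-dec prefix? b p

-- The kept prefixes over a fixed tail form an isometric subgraph of the five-dimensional cube. The
-- type checker verifies this by evaluating the decision procedure on all pairs of prefixes, for
-- each of the four kinds of tail.
unblocked-step : ∀ o i p q → ¬ Blocked (o , i) p → ¬ Blocked (o , i) q → p ≢ q →
  ∃[ j ] lookup p j ≢ lookup q j × ¬ Blocked (o , i) (flip p j)
unblocked-step = from-yes
  (∀-bit? λ o → ∀-bit? λ i → ∀-word? λ p → ∀-word? λ q →
    ¬? (blocked? (o , i) p) →-dec (¬? (blocked? (o , i) q) →-dec (¬? (p ≟ᵂ q) →-dec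
      Fin.any? λ j → ¬? (lookup p j Bool.≟ lookup q j) ×-dec ¬? (blocked? (o , i) (flip p j)))))

prefixes-disjoint : ∀ b p → p ∈ deletedPrefixes b → ¬ p ∈ deletedPrefixes (not b)
prefixes-disjoint = from-yes
  (∀-bit? λ b → ∀-word? λ p → prefix? b p →-dec ¬? (prefix? (not b) p))

prefixes-not-adjacent : ∀ b p → p ∈ deletedPrefixes b → ∀ i → ¬ flip p i ∈ deletedPrefixes (not b)
prefixes-not-adjacent = from-yes
  (∀-bit? λ b → ∀-word? λ p → prefix? b p →-dec
    Fin.all? λ i → ¬? (prefix? (not b) (flip p i)))

ends : Vec Bool m → Bool × Bool
ends {m} t = does (t ≟ᵂ replicate m O) , does (t ≟ᵂ replicate m I)

split⇒blocked : (p : Vec Bool 5) (t : Vec Bool m) → DeletedSplit p t → Blocked (ends t) p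
split⇒blocked {m} p t (O , p∈ , t≡) = O , dec-true (t ≟ᵂ replicate m O) t≡ , p∈
split⇒blocked {m} p t (I , p∈ , t≡) = I , dec-true (t ≟ᵂ replicate m I) t≡ , p∈

blocked⇒split : (p : Vec Bool 5) (t : Vec Bool m) → Blocked (ends t) p → DeletedSplit p t
blocked⇒split {m} p t (b , end , p∈) = b , p∈ , tail b end
  where
  holds : ∀ {A : Set} (a? : Dec A) → does a? ≡ true → A
  holds (yes a) _ = a
  tail : ∀ b → (if b then proj₂ (ends t) else proj₁ (ends t)) ≡ true → t ≡ replicate m b
  tail O = holds (t ≟ᵂ replicate m O)
  tail I = holds (t ≟ᵂ replicate m I)

split? : (p : Vec Bool 5) (t : Vec Bool m) → Dec (DeletedSplit p t)
split? {m} p t = ∃-bit? λ b → prefix? b p ×-dec (t ≟ᵂ replicate m b)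

-- One edge of a geodesic towards `w`; its end is kept in split form so that membership can be
-- tested by prefix and tail.
record KeptStep (p : Vec Bool 5) (t : Vec Bool m) (w : Vec Bool (5 + m)) : Set where
  constructor mkStep
  field
    {p′}     : Vec Bool 5
    {t′}     : Vec Bool m
    kept     : ¬ DeletedSplit p′ t′
    adjacent : DifferInOne (p ++ t) (p′ ++ t′)
    closer   : suc (hamming (p′ ++ t′) w) ≡ hamming (p ++ t) w

hamming-flip : (u : Vec Bool n) (i : Fin n) → hamming u (flip u i) ≡ 1
hamming-flip u i = Equivalence.to (adjacent⇔hamming≡1 u (flip u i)) (flip-adjacent u i)

flip-prefix : (p q : Vec Bool 5) (t s : Vec Bool m) (i : Fin 5) → lookup p i ≢ lookup q i →
  ¬ DeletedSplit (flip p i) t → KeptStep p t (q ++ s)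
flip-prefix p q t s i d kept = mkStep kept
  (Equivalence.from (adjacent⇔hamming≡1 (p ++ t) (flip p i ++ t))
    (trans (hamming-++ p (flip p i) t t) (cong₂ _+_ (hamming-flip p i) (hamming-refl t))))
  (begin
    suc (hamming (flip p i ++ t) (q ++ s))    ≡⟨ cong suc (hamming-++ (flip p i) q t s) ⟩
    suc (hamming (flip p i) q) + hamming t s  ≡⟨ cong (_+ hamming t s) (hamming-flip-differ p q i d) ⟩
    hamming p q + hamming t s                 ≡⟨ hamming-++ p q t s ⟨
    hamming (p ++ t) (q ++ s)                 ∎)
  where open ≡-Reasoning

flip-tail : (p q : Vec Bool 5) (t s : Vec Bool m) (j : Fin m) → lookup t j ≢ lookup s j →
  ¬ DeletedSplit p (flip t j) → KeptStep p t (q ++ s)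
flip-tail p q t s j d kept = mkStep kept
  (Equivalence.from (adjacent⇔hamming≡1 (p ++ t) (p ++ flip t j))
    (trans (hamming-++ p p t (flip t j)) (cong₂ _+_ (hamming-refl p) (hamming-flip t j))))
  (begin
    suc (hamming (p ++ flip t j) (q ++ s))    ≡⟨ cong suc (hamming-++ p q (flip t j) s) ⟩
    suc (hamming p q + hamming (flip t j) s)  ≡⟨ ℕ.+-suc (hamming p q) (hamming (flip t j) s) ⟨
    hamming p q + suc (hamming (flip t j) s)  ≡⟨ cong (hamming p q +_) (hamming-flip-differ t s j d) ⟩
    hamming p q + hamming t s                 ≡⟨ hamming-++ p q t s ⟨
    hamming (p ++ t) (q ++ s)                 ∎)
  where open ≡-Reasoning

flip-injective : (t : Vec Bool m) {i j : Fin m} → flip t i ≡ flip t j → i ≡ j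
flip-injective t {i} {j} eq = decidable-stable (i Fin.≟ j) λ i≢j →
  Bool.not-¬ refl (begin
    lookup t i          ≡⟨ Vec.lookup∘updateAt′ i j i≢j t ⟨
    lookup (flip t j) i ≡⟨ cong (λ u → lookup u i) eq ⟨
    lookup (flip t i) i ≡⟨ Vec.lookup∘updateAt i t ⟩
    not (lookup t i)    ∎)
  where open ≡-Reasoning

-- Flipping t at j would reach a deleted word with constant tail bᵐ. Leave
-- through another coordinate of the tail if there is one, and through the
-- prefix otherwise.
detour : ∀ b (p q : Vec Bool 5) (t s : Vec Bool m) (j : Fin m) → ¬ DeletedSplit q s →
  p ∈ deletedPrefixes b → flip t j ≡ replicate m b → lookup t j ≢ lookup s j →
  KeptStep p t (q ++ s)
detour {m} b p q t s j kept-q p∈ t′≡ dⱼ with flip t j ≟ᵂ s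
-- The tails now differ only at `j`. The prefixes must differ as well, since `p` followed by this
-- `s` is deleted.
... | yes refl =
  let i , d = differing-coordinate p q p≢q in flip-prefix p q t s i d (kept i)
  where
  p≢q : p ≢ q
  p≢q refl = kept-q (b , p∈ , t′≡)
  kept : ∀ i → ¬ DeletedSplit (flip p i) t
  kept i (c , p′∈ , t≡) with c Bool.≟ b
  ... | yes refl = hamming≡1+k⇒≢ t (flip t j) (hamming-flip t j) (trans t≡ (sym t′≡))
  -- Here `t` and `flip t j` are opposite constant words, which happens only for `m = 1`.
  ... | no c≢b   = prefixes-not-adjacent b p p∈ i
    (subst (λ c → flip p i ∈ deletedPrefixes c) (Bool.¬-not c≢b) p′∈)
... | no t′≢s = flip-tail p q t s j′
  (d ∘ trans (Vec.lookup∘updateAt′ j′ j (j≢j′ ∘ sym) t)) kept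
  where
  j′ : Fin m
  j′ = proj₁ (differing-coordinate (flip t j) s t′≢s)
  d : lookup (flip t j) j′ ≢ lookup s j′
  d = proj₂ (differing-coordinate (flip t j) s t′≢s)
  j≢j′ : j ≢ j′
  j≢j′ j≡j′ = subst (λ i → lookup (flip t j) i ≢ lookup s i) (sym j≡j′) d
    (trans (Vec.lookup∘updateAt j t) (sym (Bool.¬-not (dⱼ ∘ sym))))
  kept : ¬ DeletedSplit p (flip t j′)
  kept (c , p∈′ , t″≡) with c Bool.≟ b
  ... | yes refl = j≢j′ (flip-injective t (trans t′≡ (sym t″≡)))
  -- Two different flips of `t` are opposite constant words, which happens only for `m = 2`.
  ... | no c≢b   = prefixes-disjoint b p p∈
    (subst (λ c → p ∈ deletedPrefixes c) (Bool.¬-not c≢b) p∈′)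

-- Correct the tail first. A flip in the tail can fail only by producing a deleted word, and then
-- `detour` applies; once the tails agree, the finite check on prefixes takes over.
kept-step : (p q : Vec Bool 5) (t s : Vec Bool m) → ¬ DeletedSplit p t → ¬ DeletedSplit q s →
  p ++ t ≢ q ++ s → KeptStep p t (q ++ s)
kept-step {m} p q t s kept-p kept-q neq with t ≟ᵂ s
... | yes refl =
  let o , i = ends t
      j , d , kept = unblocked-step o i p q
        (kept-p ∘ blocked⇒split p t) (kept-q ∘ blocked⇒split q t) (λ p≡q → neq (cong (_++ t) p≡q))
  in flip-prefix p q t t j d (kept ∘ split⇒blocked (flip p j) t)
... | no t≢s with j , d ← differing-coordinate t s t≢s with split? p (flip t j)
...   | yes (b , p∈ , t′≡) = detour b p q t s j kept-q p∈ t′≡ d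
...   | no kept            = flip-tail p q t s j d kept

-- The graph B n

-- The proof stored in a vertex is irrelevant, but it may be used to reach a contradiction.
not-deleted : (x : Vertex (B n)) → ¬ Deleted n (value x)
not-deleted (_ , [ kept ]) del = ⊥-elim-irr (kept del)

B-step : (x y : Vertex (B (5 + m))) → value x ≢ value y →
  ∃[ z ] Adj (B (5 + m)) x z × suc (hamming (value z) (value y)) ≡ hamming (value x) (value y)
B-step x@(x₁ ∷ x₂ ∷ x₃ ∷ x₄ ∷ x₅ ∷ t , _) y@(y₁ ∷ y₂ ∷ y₃ ∷ y₄ ∷ y₅ ∷ s , _) x≢y =
  let p = x₁ ∷ x₂ ∷ x₃ ∷ x₄ ∷ x₅ ∷ []
      q = y₁ ∷ y₂ ∷ y₃ ∷ y₄ ∷ y₅ ∷ []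
      mkStep {p′} {t′} kept adjacent closer = kept-step p q t s
        (not-deleted x ∘ deleted⁺ p t) (not-deleted y ∘ deleted⁺ q s) x≢y
  in (p′ ++ t′ , [ kept ∘ deleted⁻ p′ t′ ]) , adjacent , closer

module _ {m : ℕ} where
  open IsometricEmbedding (B (5 + m)) value Refinement.value-injective (λ e → e) B-step public
    renaming (connected′ to B-connected; dist≡hamming to B-dist)
    using ()

identity-isomorphism : (G : Graph) → IsIsomorphism G G id
identity-isomorphism G = record
  { bijective = id , λ y → y , id
  ; adjacency = λ _ _ → mk⇔ id id }

B-partialCube : ∀ m (c : Connected (B (5 + m))) → IsPartialCube (B (5 + m) , c)
B-partialCube m c =
    5 + m
  , record
      { kept? = ∁? (deleted? (5 + m)) ; ~? = differInOne?
      ; ~-sym = λ {x} {y} → Graph.symm (Q (5 + m)) {x} {y} ; ~⊆Adj = λ e → e }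
  , (c , λ x y → trans (B-dist c x y) (sym (hypercube-dist (value x) (value y))))
  -- The subgraph of kept words unfolds to `B (5 + m)` itself.
  , id , identity-isomorphism (B (5 + m))

-- Automorphisms

-- Complementing the tail exchanges the two constant tails, so `σ` has to exchange the two lists of
-- prefixes. Since `σ` is an involution, inclusions suffice in `reverses`.
record ReversingSymmetry (σ : Vec Bool 5 → Vec Bool 5) : Set where
  field
    involutive : ∀ p → σ (σ p) ≡ p
    isometric  : ∀ p q → hamming (σ p) (σ q) ≡ hamming p q
    reverses   : ∀ b p → p ∈ deletedPrefixes b → σ p ∈ deletedPrefixes (not b)

module Reversal (σ : Vec Bool 5 → Vec Bool 5) (symmetry : ReversingSymmetry σ) where
  open ReversingSymmetry symmetry

  -- Matching on five letters lets `reverse` compute on a word with explicit head, so that flipping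
  -- one of the first five coordinates holds by `refl`.
  reverse : Vec Bool (5 + m) → Vec Bool (5 + m)
  reverse (a ∷ b ∷ c ∷ d ∷ e ∷ t) = σ (a ∷ b ∷ c ∷ d ∷ e ∷ []) ++ map not t

  reverse-++ : (p : Vec Bool 5) (t : Vec Bool m) → reverse (p ++ t) ≡ σ p ++ map not t
  reverse-++ (a ∷ b ∷ c ∷ d ∷ e ∷ []) t = refl


  reverse-involutive : (w : Vec Bool (5 + m)) → reverse (reverse w) ≡ w
  reverse-involutive w with p , t , refl ← splitAt 5 w = begin
    reverse (reverse (p ++ t))              ≡⟨ cong reverse (reverse-++ p t) ⟩
    reverse (σ p ++ map not t)              ≡⟨ reverse-++ (σ p) (map not t) ⟩
    σ (σ p) ++ map not (map not t)          ≡⟨ cong₂ _++_ (involutive p) not-not ⟩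
    p ++ t                                  ∎
    where
    open ≡-Reasoning
    not-not : map not (map not t) ≡ t
    not-not = trans (sym (Vec.map-∘ not not t))
      (trans (Vec.map-cong Bool.not-involutive t) (Vec.map-id t))

  reverse-isometric : (u v : Vec Bool (5 + m)) → hamming (reverse u) (reverse v) ≡ hamming u v
  reverse-isometric u v with p , t , refl ← splitAt 5 u | q , s , refl ← splitAt 5 v = begin
    hamming (reverse (p ++ t)) (reverse (q ++ s))       ≡⟨ cong₂ hamming (reverse-++ p t) (reverse-++ q s) ⟩
    hamming (σ p ++ map not t) (σ q ++ map not s)       ≡⟨ hamming-++ (σ p) (σ q) (map not t) (map not s) ⟩
    hamming (σ p) (σ q) + hamming (map not t) (map not s) ≡⟨ cong₂ _+_ (isometric p q) (hamming-map-not t s) ⟩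
    hamming p q + hamming t s                           ≡⟨ hamming-++ p q t s ⟨
    hamming (p ++ t) (q ++ s)                           ∎
    where open ≡-Reasoning

  reverse-adjacent : (u v : Vec Bool (5 + m)) → DifferInOne u v ⇔ DifferInOne (reverse u) (reverse v)
  reverse-adjacent u v = mk⇔
    (λ e → from (adjacent⇔hamming≡1 (reverse u) (reverse v))
      (trans (reverse-isometric u v) (to (adjacent⇔hamming≡1 u v) e)))
    (λ e → from (adjacent⇔hamming≡1 u v)
      (trans (sym (reverse-isometric u v)) (to (adjacent⇔hamming≡1 (reverse u) (reverse v)) e)))
    where open Equivalence

  reverse-deleted : (w : Vec Bool (5 + m)) → Deleted (5 + m) w → Deleted (5 + m) (reverse w)
  reverse-deleted {m} w del with p , t , refl ← splitAt 5 w with deleted⁻ p t del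
  ... | b , p∈ , refl = subst (Deleted (5 + m)) (sym (reverse-++ p t))
    (deleted⁺ (σ p) (map not t) (not b , reverses b p p∈ , Vec.map-replicate not b m))

  reverseᴮ : Vertex (B (5 + m)) → Vertex (B (5 + m))
  reverseᴮ {m} x@(w , _) = reverse w , [ kept ]
    where
    kept : ¬ Deleted (5 + m) (reverse w)
    -- If the image were deleted, reversing it once more would show that `w` is deleted.
    kept del = not-deleted x
      (subst (Deleted (5 + m)) (reverse-involutive w) (reverse-deleted (reverse w) del))

  reverseᴮ-involutive : (x : Vertex (B (5 + m))) → reverseᴮ (reverseᴮ x) ≡ x
  reverseᴮ-involutive x = Refinement.value-injective (reverse-involutive (value x))

  Flips : Fin (5 + m) → Set
  Flips {m} i = ∀ (w : Vec Bool (5 + m)) → lookup (reverse w) i ≡ not (lookup w i)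

  flips-tail : (j : Fin m) → Flips (suc (suc (suc (suc (suc j)))))
  flips-tail j w with p , t , refl ← splitAt 5 w = begin
    lookup (reverse (p ++ t)) (5 ↑ʳ j)   ≡⟨ cong (λ u → lookup u (5 ↑ʳ j)) (reverse-++ p t) ⟩
    lookup (σ p ++ map not t) (5 ↑ʳ j)   ≡⟨ Vec.lookup-++ʳ (σ p) (map not t) j ⟩
    lookup (map not t) j                 ≡⟨ Vec.lookup-map j not t ⟩
    not (lookup t j)                     ≡⟨ cong not (Vec.lookup-++ʳ p t j) ⟨
    not (lookup (p ++ t) (5 ↑ʳ j))       ∎
    where open ≡-Reasoning

  module _ (c : Connected (B (5 + m))) where

    -- As `x` and `y` differ at `i` only, `a` is closer to `x` exactly when it agrees with `x` at
    -- `i`. Flipping coordinate `i` therefore moves it to the opposite semicube.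
    reverse-closer : (x y a : Vertex (B (5 + m))) ((i , _) : Adj (B (5 + m)) x y) → Flips i →
      Closer (B (5 + m) , c) x y a → Closer (B (5 + m) , c) y x (reverseᴮ a)
    reverse-closer x y a e@(i , _) flips closer =
      subst₂ _<_ (sym (B-dist c y (reverseᴮ a))) (sym (B-dist c x (reverseᴮ a)))
        (ℕ.≤-reflexive (hamming-adjacent-differ (value x) (value y) e (reverse (value a)) differs))
      where
      same : lookup (value x) i ≡ lookup (value a) i
      same = decidable-stable (lookup (value x) i Bool.≟ lookup (value a) i) λ d →
        ℕ.<-asym (subst₂ _<_ (B-dist c x a) (B-dist c y a) closer)
          (ℕ.≤-reflexive (hamming-adjacent-differ (value x) (value y) e (value a) d))
      differs : lookup (value x) i ≢ lookup (reverse (value a)) i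
      differs eq = Bool.not-¬ same (trans eq (flips (value a)))

    reverse-semicube : (x y : Vertex (B (5 + m))) ((i , _) : Adj (B (5 + m)) x y) → Flips i →
      Vertex (semicube (B (5 + m) , c) x y) → Vertex (semicube (B (5 + m) , c) y x)
    reverse-semicube x y e flips (a , [ closer ]) = reverseᴮ a , [ reverse-closer x y a e flips closer ]

    reverse-isomorphism : (x y : Vertex (B (5 + m))) ((i , _) : Adj (B (5 + m)) x y) → Flips i →
      semicube (B (5 + m) , c) x y ≅ semicube (B (5 + m) , c) y x
    reverse-isomorphism x y e flips = f , record
      { bijective = (λ {a} {b} eq → trans (sym (g∘f a)) (trans (cong g eq) (g∘f b)))
                  , λ b → g b , λ { refl → f∘g b }
      ; adjacency = λ a b → reverse-adjacent (value (value a)) (value (value b)) }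
      where
      f = reverse-semicube x y e flips
      -- The reversed edge has the same coordinate, so `flips` serves in both directions.
      g = reverse-semicube y x (Graph.symm (B (5 + m)) {x} {y} e) flips
      g∘f : ∀ a → g (f a) ≡ a
      g∘f a = Refinement.value-injective (reverseᴮ-involutive (value a))
      f∘g : ∀ b → f (g b) ≡ b
      f∘g b = Refinement.value-injective (reverseᴮ-involutive (value b))

translate : Vec Bool 5 → Vec Bool 5
translate (a ∷ b ∷ c ∷ d ∷ e ∷ []) = not a ∷ not b ∷ not c ∷ not d ∷ e ∷ []

complementSwap : Vec Bool 5 → Vec Bool 5
complementSwap (a ∷ b ∷ c ∷ d ∷ e ∷ []) = not a ∷ not b ∷ not d ∷ not c ∷ not e ∷ []

reversingSymmetry? : ∀ σ → Dec (ReversingSymmetry σ)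
reversingSymmetry? σ = map′
  (λ (i , d , r) → record { involutive = i ; isometric = d ; reverses = r })
  (λ s → let open ReversingSymmetry s in involutive , isometric , reverses)
  ((∀-word? λ p → σ (σ p) ≟ᵂ p) ×-dec
   ((∀-word? λ p → ∀-word? λ q → hamming (σ p) (σ q) ℕ.≟ hamming p q) ×-dec
    (∀-bit? λ b → ∀-word? λ p → prefix? b p →-dec prefix? (not b) (σ p))))

module Translate      = Reversal translate      (from-yes (reversingSymmetry? translate))
module ComplementSwap = Reversal complementSwap (from-yes (reversingSymmetry? complementSwap))

B-semicubes : ∀ m (c : Connected (B (5 + m))) → HasIsomorphicOppositeSemicubes (B (5 + m) , c)
B-semicubes m c _ _ _ x y (e@(i , _) , _) = exchange i refl
  where
  by-translation : Translate.Flips (proj₁ e) → semicube (B (5 + m) , c) x y ≅ semicube (B (5 + m) , c) y x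
  by-translation = Translate.reverse-isomorphism c x y e
  -- Matching on the equation instantiates the coordinate of the edge, after which `Flips` refers to
  -- an explicit position.
  exchange : ∀ i → i ≡ proj₁ e → semicube (B (5 + m) , c) x y ≅ semicube (B (5 + m) , c) y x
  exchange zero                                refl = by-translation λ { (_ ∷ _ ∷ _ ∷ _ ∷ _ ∷ _) → refl }
  exchange (suc zero)                          refl = by-translation λ { (_ ∷ _ ∷ _ ∷ _ ∷ _ ∷ _) → refl }
  exchange (suc (suc zero))                    refl = by-translation λ { (_ ∷ _ ∷ _ ∷ _ ∷ _ ∷ _) → refl }
  exchange (suc (suc (suc zero)))              refl = by-translation λ { (_ ∷ _ ∷ _ ∷ _ ∷ _ ∷ _) → refl }
  exchange (suc (suc (suc (suc zero))))        refl =
    ComplementSwap.reverse-isomorphism c x y e λ { (_ ∷ _ ∷ _ ∷ _ ∷ _ ∷ _) → refl }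
  exchange (suc (suc (suc (suc (suc j)))))     refl = by-translation (Translate.flips-tail j)

-- Failure of antipodality

prefixVertex : ∀ b (p : Vec Bool 5) → (∀ c → ¬ p ∈ deletedPrefixes c) → Vertex (B (5 + m))
prefixVertex {m} b p p∉ = p ++ replicate m b , [ (λ (c , p∈ , _) → p∉ c p∈) ∘ deleted⁻ p (replicate m b) ]

undeleted? : ∀ p → Dec (∀ c → ¬ p ∈ deletedPrefixes c)
undeleted? p = ∀-bit? λ c → ¬? (prefix? c p)

lonely : Vertex (B (5 + m))
lonely = prefixVertex O p (from-yes (undeleted? p))
  where p = O ∷ O ∷ I ∷ O ∷ O ∷ []

-- Distance `5 + m` is attained only at the complement, which is the deleted word 11011·1ᵐ.
lonely-no-antipode : (y : Vertex (B (5 + m))) → hamming (value (lonely {m})) (value y) < 5 + m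
lonely-no-antipode {m} y = ℕ.≰⇒> λ n≤h → not-deleted y
  (subst (Deleted (5 + m)) (sym (n≤hamming⇒complement (value (lonely {m})) (value y) n≤h))
    (deleted⁺ (I ∷ I ∷ O ∷ I ∷ I ∷ []) (map not (replicate m O))
      (I , here refl , Vec.map-replicate not O m)))

-- Every vertex at distance `4 + m` from `lonely` is as far away as possible, hence a relative
-- antipode; two such vertices contradict uniqueness.
B-notAntipodal : ∀ m (c : Connected (B (5 + m))) → ¬ IsAntipodal (B (5 + m) , c)
B-notAntipodal m c antipodal =
  let _ , _ , unique = antipodal (lonely {m})
  in y₁≢y₂ (trans (sym (unique (farthest y₁ (cong (4 +_) (hamming-replicate m)))))
                  (unique (farthest y₂ (cong (4 +_) (hamming-replicate m)))))
  where
  p₁ p₂ : Vec Bool 5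
  -- The missing complement 11011·1ᵐ with its second, respectively first, letter flipped.
  p₁ = I ∷ O ∷ O ∷ I ∷ I ∷ []
  p₂ = O ∷ I ∷ O ∷ I ∷ I ∷ []
  y₁ y₂ : Vertex (B (5 + m))
  y₁ = prefixVertex I p₁ (from-yes (undeleted? p₁))
  y₂ = prefixVertex I p₂ (from-yes (undeleted? p₂))
  p₁≢p₂ : p₁ ≢ p₂
  p₁≢p₂ ()
  y₁≢y₂ : y₁ ≢ y₂
  y₁≢y₂ eq = p₁≢p₂
    (Vec.++-injectiveˡ {ys = replicate m I} {zs = replicate m I} p₁ p₂ (cong value eq))
  farthest : ∀ y → hamming (value (lonely {m})) (value y) ≡ 4 + m →
    IsRelativeAntipode (B (5 + m) , c) lonely y
  farthest y h≡4+m z _ = subst₂ _≤_ (sym (B-dist c lonely z)) (sym (trans (B-dist c lonely y) h≡4+m))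
    (s≤s⁻¹ (lonely-no-antipode z))

dist≤diam : (G : ConnectedGraph) → ∀ x y → dist G x y ≤ diam G
dist≤diam G x y = All.lookup (xs≤max 0 _)
  (∈-cartesianProductWith⁺ (dist G) (Graph.complete (graph G) x) (Graph.complete (graph G) y))

-- A complementary pair of kept words shows that the diameter is at least `5 + m`, a distance that
-- no vertex has from `lonely`.
B-notEven : ∀ m (c : Connected (B (5 + m))) → ¬ IsEven (B (5 + m) , c)
B-notEven m c even = let y , antipode , _ = even (lonely {m}) in
  ℕ.<⇒≱ (lonely-no-antipode y) (begin
    5 + m                             ≡⟨ cong (5 +_) (hamming-replicate m) ⟨
    hamming (value a) (value b)       ≡⟨ B-dist c a b ⟨
    dist G a b                        ≤⟨ dist≤diam G a b ⟩
    diam G                            ≡⟨ antipode ⟨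
    dist G lonely y                   ≡⟨ B-dist c lonely y ⟩
    hamming (value (lonely {m})) (value y) ∎)
  where
  open ℕ.≤-Reasoning
  G = B (5 + m) , c
  p q : Vec Bool 5
  -- Two complementary prefixes, neither of them in the lists of deleted prefixes.
  p = O ∷ I ∷ O ∷ O ∷ O ∷ []
  q = I ∷ O ∷ I ∷ I ∷ I ∷ []
  a b : Vertex (B (5 + m))
  a = prefixVertex O p (from-yes (undeleted? p))
  b = prefixVertex I q (from-yes (undeleted? q))

-- The conclusion as a predicate of `n`, to be transported along the equation `5 + (n ∸ 5) ≡ n`.
CounterexampleAt : ℕ → Set₁
CounterexampleAt n = Σ[ c ∈ Connected (B n) ]
    ( IsPartialCube (B n , c)
    × HasIsomorphicOppositeSemicubes (B n , c)
    × ¬ IsAntipodal (B n , c)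
    × ¬ IsHarmonicEven (B n , c) )

counterexample : ∀ m → CounterexampleAt (5 + m)
counterexample m = c , B-partialCube m c , B-semicubes m c , B-notAntipodal m c , B-notEven m c ∘ proj₁
  where
  c : Connected (B (5 + m))
  c = B-connected

theorem3p5 : (n : ℕ) → 5 ≤ n →
    Σ[ c ∈ Connected (B n) ]
    ( IsPartialCube (B n , c)
    × HasIsomorphicOppositeSemicubes (B n , c)
    × ¬ IsAntipodal (B n , c)
    × ¬ IsHarmonicEven (B n , c) )
theorem3p5 n 5≤n = subst CounterexampleAt (ℕ.m+[n∸m]≡n 5≤n) (counterexample _)
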